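{- Let $f(x), g(x) \in \mathbf{F}_q[x]$ be monic polynomials with $f(0) \neq 0$ and $g(0) \neq 0$. Then the $a$-reciprocal of the product $f(x)g(x)$ is the product of the $a$-reciprocals of $f(x)$ and $g(x)$: $$\widehat{(fg)}_a(x) = \hat{f}_a(x)\cdot \hat{g}_a(x).$$
   Context: Let $q=p^e$ be an odd prime power, $\mathbf{F}_q$ the finite field with $q$ elements, and $a \in \mathbf{F}_q$ with $a \neq 0$. For a monic polynomial $f(x)=\sum_{i=0}^n b_i x^i \in \mathbf{F}_q[x]$ of degree $n$ with $f(0)\neq 0$, the $a$-reciprocal of $f$ is $\hat{f}_a(x) := \frac{x^n}{f(0)} f\left(\frac{a}{x}\right) = \frac{1}{b_0}\sum_{i=0}^n b_i a^i x^{n-i}$, which is again a monic polynomial. -}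

module Defs where

open import Algebra.Apartness.Bundles using (HeytingField; HeytingCommutativeRing)
open import Algebra.Apartness.Structures using (IsHeytingField)
open import Algebra.Bundles using (CommutativeRing)
open import Algebra.Core using (Op₁; Op₂)
open import Algebra.Definitions using (Invertible)
import Algebra.Apartness.Properties.HeytingCommutativeRing as HeytingProperties
import Algebra.Properties.Semiring.Exp as Exp
import Algebra.Properties.CommutativeSemigroup as CommutativeSemigroupProperties
open import Data.Fin.Base using (Fin)
import Data.Fin.Properties as Fin
open import Data.List.Base using (List; []; _∷_; _++_; [_]; map; foldr; replicate; upTo)
open import Data.List.Relation.Unary.All using (all?)
open import Data.Nat.Base using (ℕ; zero; suc; _∸_)
open import Data.Product.Base using (_,_; proj₁)
open import Function.Bundles using (Inverse)
open import Function.Properties.Inverse using (Inverse⇒Injection)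
open import Level using (_⊔_) renaming (suc to lsuc)
open import Relation.Binary.Core using (Rel)
open import Relation.Binary.Definitions using (Decidable)
import Relation.Binary.PropositionalEquality.Properties as ≡
open import Relation.Nullary.Decidable using (yes; no; via-injection)
open import Relation.Nullary.Negation using (¬_)

-- A Heyting field whose apartness is the denial of equality: for a finite
-- carrier (where equality is decidable) this is an ordinary field.
record FiniteField c ℓ (q : ℕ) : Set (lsuc (c ⊔ ℓ)) where
  infix  8 -_
  infixl 7 _*_
  infixl 6 _+_
  infix  4 _≈_ _≉_ _≟_
  field
    Carrier : Set c
    _≈_     : Rel Carrier ℓ
    _+_     : Op₂ Carrier
    _*_     : Op₂ Carrier
    -_      : Op₁ Carrier
    0#      : Carrier
    1#      : Carrier

  _≉_ : Rel Carrier ℓ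
  x ≉ y = ¬ (x ≈ y)

  field
    isHeytingField : IsHeytingField _≈_ _≉_ _+_ _*_ -_ 0# 1#

  heytingField : HeytingField c ℓ ℓ
  heytingField = record { isHeytingField = isHeytingField }

  open HeytingField heytingField using (heytingCommutativeRing; #⇒invertible)

  commutativeRing : CommutativeRing c ℓ
  commutativeRing = HeytingCommutativeRing.commutativeRing heytingCommutativeRing

  open CommutativeRing commutativeRing using (setoid; trans; sym; *-congˡ; *-congʳ)

  field
    enumeration : Inverse setoid (≡.setoid (Fin q))

  _≟_ : Decidable _≈_
  _≟_ = via-injection (Inverse⇒Injection enumeration) Fin._≟_

  open HeytingProperties heytingCommutativeRing using (x-0≈x; x#0y#0→xy#0)

  invertible : ∀ {x} → x ≉ 0# → Invertible _≈_ 1# _*_ x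
  invertible {x} x≉0 with #⇒invertible x≉0
  ... | y , yx≈1 , xy≈1 =
    y , trans (*-congˡ (sym (x-0≈x x))) yx≈1 , trans (*-congʳ (sym (x-0≈x x))) xy≈1

  inverse : (x : Carrier) → x ≉ 0# → Carrier
  inverse x x≉0 = proj₁ (invertible x≉0)

  x≉0y≉0→xy≉0 : ∀ {x y} → x ≉ 0# → y ≉ 0# → x * y ≉ 0#
  x≉0y≉0→xy≉0 = x#0y#0→xy#0

module Polynomials {c ℓ} (R : CommutativeRing c ℓ) where
  open CommutativeRing R
  open import Relation.Binary.Reasoning.Setoid setoid
  open CommutativeSemigroupProperties +-commutativeSemigroup using (interchange)
  open CommutativeSemigroupProperties *-commutativeSemigroup using (x∙yz≈y∙xz)

  infixl 6 _⊕_
  infixl 7 _⊗_ _⊙_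
  infix  4 _≋_

  -- Coefficients, constant term first; trailing zeros are allowed, and are
  -- ignored by _≋_.
  Poly : Set c
  Poly = List Carrier

  coeff : Poly → ℕ → Carrier
  coeff []      _       = 0#
  coeff (b ∷ f) zero    = b
  coeff (b ∷ f) (suc i) = coeff f i

  _≋_ : Rel Poly ℓ
  f ≋ g = ∀ i → coeff f i ≈ coeff g i

  _⊕_ : Op₂ Poly
  []      ⊕ g       = g
  (b ∷ f) ⊕ []      = b ∷ f
  (b ∷ f) ⊕ (d ∷ g) = (b + d) ∷ (f ⊕ g)

  _⊙_ : Carrier → Poly → Poly
  s ⊙ f = map (s *_) f

  -- (b + x f) g = b g + x (f g)
  _⊗_ : Op₂ Poly
  []      ⊗ g = []
  (b ∷ f) ⊗ g = (b ⊙ g) ⊕ (0# ∷ (f ⊗ g))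

  monomial : Carrier → ℕ → Poly
  monomial b k = replicate k 0# ++ [ b ]

  -- ∑≤ n F = F 0 + F 1 + … + F n
  ∑≤ : ℕ → (ℕ → Poly) → Poly
  ∑≤ n F = foldr _⊕_ [] (map F (upTo (suc n)))

  eval : Poly → Carrier → Carrier
  eval []      x = 0#
  eval (b ∷ f) x = b + x * eval f x

  eval-⊕ : ∀ f g x → eval (f ⊕ g) x ≈ eval f x + eval g x
  eval-⊕ []      g       x = sym (+-identityˡ _)
  eval-⊕ (b ∷ f) []      x = sym (+-identityʳ _)
  eval-⊕ (b ∷ f) (d ∷ g) x = begin
    (b + d) + x * eval (f ⊕ g) x             ≈⟨ +-congˡ (*-congˡ (eval-⊕ f g x)) ⟩
    (b + d) + x * (eval f x + eval g x)      ≈⟨ +-congˡ (distribˡ x _ _) ⟩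
    (b + d) + (x * eval f x + x * eval g x)  ≈⟨ interchange b d _ _ ⟩
    (b + x * eval f x) + (d + x * eval g x)  ∎

  eval-⊙ : ∀ s f x → eval (s ⊙ f) x ≈ s * eval f x
  eval-⊙ s []      x = sym (zeroʳ s)
  eval-⊙ s (b ∷ f) x = begin
    s * b + x * eval (s ⊙ f) x  ≈⟨ +-congˡ (*-congˡ (eval-⊙ s f x)) ⟩
    s * b + x * (s * eval f x)  ≈⟨ +-congˡ (x∙yz≈y∙xz x s _) ⟩
    s * b + s * (x * eval f x)  ≈⟨ distribˡ s b _ ⟨
    s * (b + x * eval f x)      ∎

  eval-⊗ : ∀ f g x → eval (f ⊗ g) x ≈ eval f x * eval g x
  eval-⊗ []      g x = sym (zeroˡ _)
  eval-⊗ (b ∷ f) g x = begin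
    eval ((b ⊙ g) ⊕ (0# ∷ (f ⊗ g))) x            ≈⟨ eval-⊕ (b ⊙ g) _ x ⟩
    eval (b ⊙ g) x + (0# + x * eval (f ⊗ g) x)   ≈⟨ +-cong (eval-⊙ b g x) (+-identityˡ _) ⟩
    b * eval g x + x * eval (f ⊗ g) x            ≈⟨ +-congˡ (*-congˡ (eval-⊗ f g x)) ⟩
    b * eval g x + x * (eval f x * eval g x)     ≈⟨ +-congˡ (*-assoc x _ _) ⟨
    b * eval g x + (x * eval f x) * eval g x     ≈⟨ distribʳ _ b _ ⟨
    (b + x * eval f x) * eval g x                ∎

module Reciprocal {c ℓ} {q : ℕ} (F : FiniteField c ℓ q) where
  open FiniteField F
  open CommutativeRing commutativeRing using (semiring; sym; trans)
  open Exp semiring using (_^_)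
  open Polynomials commutativeRing public

  -- deg f = 0 when f is the zero polynomial.
  deg : Poly → ℕ
  deg []      = 0
  deg (b ∷ f) with all? (_≟ 0#) f
  ... | yes _ = 0
  ... | no  _ = suc (deg f)

  Monic : Poly → Set ℓ
  Monic f = coeff f (deg f) ≈ 1#

  NonzeroAt0 : Poly → Set ℓ
  NonzeroAt0 f = eval f 0# ≉ 0#

  ⊗-nonzeroAt0 : ∀ f g → NonzeroAt0 f → NonzeroAt0 g → NonzeroAt0 (f ⊗ g)
  ⊗-nonzeroAt0 f g f0 g0 fg≈0 =
    x≉0y≉0→xy≉0 f0 g0 (trans (sym (eval-⊗ f g 0#)) fg≈0)

  -- (1 / f(0)) ∑_{i ≤ n} b_i a^i x^{n-i}, where n = deg f
  reciprocal : Carrier → (f : Poly) → NonzeroAt0 f → Poly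
  reciprocal a f f0 =
    inverse (eval f 0#) f0 ⊙
      ∑≤ (deg f) (λ i → monomial (coeff f i * (a ^ i)) (deg f ∸ i))

{-# OPTIONS --safe #-}

-- Let R n f = ∑_{i ≤ n} b_i a^i x^{n-i}.  For f and g of degrees at most m and n,
-- R (m + n) (f g) = R m f · R n g follows by induction on f = b + x f′, since R is
-- linear and R (m + 1) f = b x^{m+1} + a · R m f′.  The theorem is the case of
-- m = deg f and n = deg g, divided by f(0) g(0); monicity enters only through
-- deg (f g) = deg f + deg g.
module Submission where

open import Defs
open import Algebra.Bundles using (CommutativeRing)
import Algebra.Properties.CommutativeSemigroup as CommutativeSemigroupProperties
import Algebra.Properties.Semiring.Exp as Exp
open import Data.List.Base using ([]; _∷_; _++_; foldr; map; replicate; applyUpTo)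
open import Data.List.Properties using (map-upTo; map-applyUpTo)
open import Data.List.Relation.Unary.All using (All; []; _∷_; all?)
open import Data.Nat.Base using (ℕ; zero; suc; _∸_; _^_; _≥_; _<_; z≤n; s≤s; s≤s⁻¹)
import Data.Nat.Base as ℕ
import Data.Nat.Properties as ℕ
open import Data.Nat.Divisibility using (_∣_)
open import Data.Nat.Primality using (Prime)
open import Data.Product.Base using (proj₁; proj₂)
open import Function.Base using (_∘_)
open import Relation.Binary.PropositionalEquality as ≡ using (_≡_)
open import Relation.Nullary.Decidable using (yes; no)
open import Relation.Nullary.Negation using (¬_; contradiction)

-- Coefficients of sums, scalar multiples and products over a commutative ring

module PolynomialProperties {c ℓ} (R : CommutativeRing c ℓ) where
  open CommutativeRing R
  open Polynomials R
  open import Relation.Binary.Reasoning.Setoid setoid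
  open CommutativeSemigroupProperties +-commutativeSemigroup using (interchange)
  open CommutativeSemigroupProperties *-commutativeSemigroup using (x∙yz≈y∙xz)

  coeff-⊕ : ∀ f g k → coeff (f ⊕ g) k ≈ coeff f k + coeff g k
  coeff-⊕ []      g       k       = sym (+-identityˡ _)
  coeff-⊕ (b ∷ f) []      k       = sym (+-identityʳ _)
  coeff-⊕ (b ∷ f) (d ∷ g) zero    = refl
  coeff-⊕ (b ∷ f) (d ∷ g) (suc k) = coeff-⊕ f g k

  coeff-⊙ : ∀ s f k → coeff (s ⊙ f) k ≈ s * coeff f k
  coeff-⊙ s []      k       = sym (zeroʳ s)
  coeff-⊙ s (b ∷ f) zero    = refl
  coeff-⊙ s (b ∷ f) (suc k) = coeff-⊙ s f k

  -- The recursion for coefficients of a product, used in place of the convolution formula: the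
  -- inductions on the first factor rest on it.
  coeff-∷-⊗ : ∀ b f g k →
    coeff ((b ∷ f) ⊗ g) k ≈ b * coeff g k + coeff (0# ∷ (f ⊗ g)) k
  coeff-∷-⊗ b f g k = trans (coeff-⊕ (b ⊙ g) _ k) (+-congʳ (coeff-⊙ b g k))

  -- Applies an induction hypothesis about `f ⊗ g` underneath the factor x, without splitting on the
  -- index.
  0∷-cong : ∀ f g → f ≋ g → (0# ∷ f) ≋ (0# ∷ g)
  0∷-cong f g f≋g zero    = refl
  0∷-cong f g f≋g (suc k) = f≋g k

  ⊗-zeroˡ : ∀ f g → f ≋ [] → f ⊗ g ≋ []
  ⊗-zeroˡ []      g f≋0 k = refl
  ⊗-zeroˡ (b ∷ f) g f≋0 k = begin
    coeff ((b ∷ f) ⊗ g) k                     ≈⟨ coeff-∷-⊗ b f g k ⟩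
    b * coeff g k + coeff (0# ∷ (f ⊗ g)) k    ≈⟨ +-cong (*-congʳ (f≋0 0)) (shifted k) ⟩
    0# * coeff g k + 0#                       ≈⟨ +-identityʳ _ ⟩
    0# * coeff g k                            ≈⟨ zeroˡ _ ⟩
    0#                                        ∎
    where
    shifted : (0# ∷ (f ⊗ g)) ≋ []
    shifted zero    = refl
    shifted (suc k) = ⊗-zeroˡ f g (f≋0 ∘ suc) k

  ⊗-congʳ : ∀ f f′ g → f ≋ f′ → f ⊗ g ≋ f′ ⊗ g
  -- Equal polynomials may be lists of different lengths. Once one list runs out, the other consists
  -- of zeros and `⊗-zeroˡ` applies.
  ⊗-congʳ []      f′        g eq k = sym (⊗-zeroˡ f′ g (sym ∘ eq) k)
  ⊗-congʳ (b ∷ f) []        g eq k = ⊗-zeroˡ (b ∷ f) g eq k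
  ⊗-congʳ (b ∷ f) (b′ ∷ f′) g eq k = begin
    coeff ((b ∷ f) ⊗ g) k                       ≈⟨ coeff-∷-⊗ b f g k ⟩
    b * coeff g k + coeff (0# ∷ (f ⊗ g)) k
      ≈⟨ +-cong (*-congʳ (eq 0)) (0∷-cong (f ⊗ g) _ (⊗-congʳ f f′ g (eq ∘ suc)) k) ⟩
    b′ * coeff g k + coeff (0# ∷ (f′ ⊗ g)) k    ≈⟨ coeff-∷-⊗ b′ f′ g k ⟨
    coeff ((b′ ∷ f′) ⊗ g) k                     ∎

  coeff-0∷-⊕ : ∀ f g k → coeff (0# ∷ (f ⊕ g)) k ≈ coeff (0# ∷ f) k + coeff (0# ∷ g) k
  coeff-0∷-⊕ f g zero    = sym (+-identityˡ 0#)
  coeff-0∷-⊕ f g (suc k) = coeff-⊕ f g k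

  coeff-0∷-⊙ : ∀ s f k → coeff (0# ∷ (s ⊙ f)) k ≈ s * coeff (0# ∷ f) k
  coeff-0∷-⊙ s f zero    = sym (zeroʳ s)
  coeff-0∷-⊙ s f (suc k) = coeff-⊙ s f k

  ⊗-distribʳ-⊕ : ∀ h f g → (f ⊕ g) ⊗ h ≋ (f ⊗ h) ⊕ (g ⊗ h)
  ⊗-distribʳ-⊕ h []      g       k = refl
  ⊗-distribʳ-⊕ h (b ∷ f) []      k = sym (trans (coeff-⊕ ((b ∷ f) ⊗ h) [] k) (+-identityʳ _))
  ⊗-distribʳ-⊕ h (b ∷ f) (d ∷ g) k = begin
    coeff (((b + d) ∷ (f ⊕ g)) ⊗ h) k
      ≈⟨ coeff-∷-⊗ (b + d) (f ⊕ g) h k ⟩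
    (b + d) * coeff h k + coeff (0# ∷ ((f ⊕ g) ⊗ h)) k
      ≈⟨ +-cong (distribʳ _ b d) (0∷-cong ((f ⊕ g) ⊗ h) _ (⊗-distribʳ-⊕ h f g) k) ⟩
    (b * coeff h k + d * coeff h k) + coeff (0# ∷ ((f ⊗ h) ⊕ (g ⊗ h))) k
      ≈⟨ +-congˡ (coeff-0∷-⊕ (f ⊗ h) (g ⊗ h) k) ⟩
    (b * coeff h k + d * coeff h k) + (coeff (0# ∷ (f ⊗ h)) k + coeff (0# ∷ (g ⊗ h)) k)
      ≈⟨ interchange _ _ _ _ ⟩
    (b * coeff h k + coeff (0# ∷ (f ⊗ h)) k) + (d * coeff h k + coeff (0# ∷ (g ⊗ h)) k)
      ≈⟨ +-cong (coeff-∷-⊗ b f h k) (coeff-∷-⊗ d g h k) ⟨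
    coeff ((b ∷ f) ⊗ h) k + coeff ((d ∷ g) ⊗ h) k
      ≈⟨ coeff-⊕ ((b ∷ f) ⊗ h) ((d ∷ g) ⊗ h) k ⟨
    coeff (((b ∷ f) ⊗ h) ⊕ ((d ∷ g) ⊗ h)) k ∎

  ⊙-⊗-assoc : ∀ s f g → (s ⊙ f) ⊗ g ≋ s ⊙ (f ⊗ g)
  ⊙-⊗-assoc s []      g k = refl
  ⊙-⊗-assoc s (b ∷ f) g k = begin
    coeff (((s * b) ∷ (s ⊙ f)) ⊗ g) k
      ≈⟨ coeff-∷-⊗ (s * b) (s ⊙ f) g k ⟩
    (s * b) * coeff g k + coeff (0# ∷ ((s ⊙ f) ⊗ g)) k
      ≈⟨ +-cong (*-assoc s b _) (0∷-cong ((s ⊙ f) ⊗ g) _ (⊙-⊗-assoc s f g) k) ⟩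
    s * (b * coeff g k) + coeff (0# ∷ (s ⊙ (f ⊗ g))) k
      ≈⟨ +-congˡ (coeff-0∷-⊙ s (f ⊗ g) k) ⟩
    s * (b * coeff g k) + s * coeff (0# ∷ (f ⊗ g)) k
      ≈⟨ distribˡ s _ _ ⟨
    s * (b * coeff g k + coeff (0# ∷ (f ⊗ g)) k)
      ≈⟨ *-congˡ (coeff-∷-⊗ b f g k) ⟨
    s * coeff ((b ∷ f) ⊗ g) k
      ≈⟨ coeff-⊙ s ((b ∷ f) ⊗ g) k ⟨
    coeff (s ⊙ ((b ∷ f) ⊗ g)) k ∎

  ⊗-⊙-comm : ∀ s f g → f ⊗ (s ⊙ g) ≋ s ⊙ (f ⊗ g)
  ⊗-⊙-comm s []      g k = refl
  ⊗-⊙-comm s (b ∷ f) g k = begin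
    coeff ((b ∷ f) ⊗ (s ⊙ g)) k
      ≈⟨ coeff-∷-⊗ b f (s ⊙ g) k ⟩
    b * coeff (s ⊙ g) k + coeff (0# ∷ (f ⊗ (s ⊙ g))) k
      ≈⟨ +-cong (*-congˡ (coeff-⊙ s g k)) (0∷-cong (f ⊗ (s ⊙ g)) _ (⊗-⊙-comm s f g) k) ⟩
    b * (s * coeff g k) + coeff (0# ∷ (s ⊙ (f ⊗ g))) k
      ≈⟨ +-cong (x∙yz≈y∙xz b s _) (coeff-0∷-⊙ s (f ⊗ g) k) ⟩
    s * (b * coeff g k) + s * coeff (0# ∷ (f ⊗ g)) k
      ≈⟨ distribˡ s _ _ ⟨
    s * (b * coeff g k + coeff (0# ∷ (f ⊗ g)) k)
      ≈⟨ *-congˡ (coeff-∷-⊗ b f g k) ⟨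
    s * coeff ((b ∷ f) ⊗ g) k
      ≈⟨ coeff-⊙ s ((b ∷ f) ⊗ g) k ⟨
    coeff (s ⊙ ((b ∷ f) ⊗ g)) k ∎

  monomial-⊗ : ∀ b m g → monomial b m ⊗ g ≋ replicate m 0# ++ (b ⊙ g)
  monomial-⊗ b zero    g k = begin
    coeff ((b ⊙ g) ⊕ (0# ∷ [])) k         ≈⟨ coeff-⊕ (b ⊙ g) _ k ⟩
    coeff (b ⊙ g) k + coeff (0# ∷ []) k   ≈⟨ +-congˡ (zeros k) ⟩
    coeff (b ⊙ g) k + 0#                  ≈⟨ +-identityʳ _ ⟩
    coeff (b ⊙ g) k                       ∎
    where
    zeros : (0# ∷ []) ≋ []
    zeros zero    = refl
    zeros (suc k) = refl
  monomial-⊗ b (suc m) g k = begin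
    coeff ((0# ∷ monomial b m) ⊗ g) k                   ≈⟨ coeff-∷-⊗ 0# (monomial b m) g k ⟩
    0# * coeff g k + coeff (0# ∷ (monomial b m ⊗ g)) k  ≈⟨ +-congʳ (zeroˡ _) ⟩
    0# + coeff (0# ∷ (monomial b m ⊗ g)) k              ≈⟨ +-identityˡ _ ⟩
    coeff (0# ∷ (monomial b m ⊗ g)) k                   ≈⟨ 0∷-cong (monomial b m ⊗ g) _ (monomial-⊗ b m g) k ⟩
    coeff (0# ∷ (replicate m 0# ++ (b ⊙ g))) k          ∎

  -- Degree bounds and top coefficients of products

  -- An upper bound instead of the exact degree: it passes to tails, holds for zero polynomials with
  -- every `n`, and needs no decision of equality in the ring.
  DegreeAtMost : ℕ → Poly → Set ℓ
  DegreeAtMost n f = ∀ i → n < i → coeff f i ≈ 0#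

  tail-degree : ∀ {n b f} → DegreeAtMost (suc n) (b ∷ f) → DegreeAtMost n f
  tail-degree f≤ i n<i = f≤ (suc i) (s≤s n<i)

  tail≋0 : ∀ {b f} → DegreeAtMost 0 (b ∷ f) → f ≋ []
  tail≋0 f≤ i = f≤ (suc i) (s≤s z≤n)

  -- The base case of inductions on a degree bound. With bound 0 the tail vanishes but need not be
  -- empty, so the list is first replaced by `b ∷ []`.
  coeff-const-⊗ : ∀ b f g → f ≋ [] → ∀ k → coeff ((b ∷ f) ⊗ g) k ≈ b * coeff g k
  coeff-const-⊗ b f g f≋0 k = begin
    coeff ((b ∷ f) ⊗ g) k
      ≈⟨ ⊗-congʳ (b ∷ f) (b ∷ []) g (λ { zero → refl ; (suc i) → f≋0 i }) k ⟩
    coeff (monomial b 0 ⊗ g) k              ≈⟨ monomial-⊗ b 0 g k ⟩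
    coeff (b ⊙ g) k                         ≈⟨ coeff-⊙ b g k ⟩
    b * coeff g k                           ∎

  ⊗-degree : ∀ m n f g → DegreeAtMost m f → DegreeAtMost n g →
             DegreeAtMost (m ℕ.+ n) (f ⊗ g)
  ⊗-degree m       n []      g f≤ g≤ i       _  = refl
  ⊗-degree zero    n (b ∷ f) g f≤ g≤ i       n< =
    trans (coeff-const-⊗ b f g (tail≋0 {b} f≤) i) (trans (*-congˡ (g≤ i n<)) (zeroʳ b))
  ⊗-degree (suc m) n (b ∷ f) g f≤ g≤ (suc i) (s≤s m+n<i) = begin
    coeff ((b ∷ f) ⊗ g) (suc i)             ≈⟨ coeff-∷-⊗ b f g (suc i) ⟩
    b * coeff g (suc i) + coeff (f ⊗ g) i
      ≈⟨ +-cong (*-congˡ (g≤ (suc i) n<1+i)) (⊗-degree m n f g (tail-degree {b = b} {f} f≤) g≤ i m+n<i) ⟩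
    b * 0# + 0#                             ≈⟨ +-identityʳ _ ⟩
    b * 0#                                  ≈⟨ zeroʳ b ⟩
    0#                                      ∎
    where
    n<1+i : n < suc i
    n<1+i = ℕ.m<n⇒m<1+n (ℕ.≤-<-trans (ℕ.m≤n+m n m) m+n<i)

  -- In b g + x (f g), the summand b g has degree at most `n`, so it contributes nothing at
  -- `suc (m + n)`; the value there comes from the tail of the first factor.
  ⊗-leading : ∀ m n f g → DegreeAtMost m f → DegreeAtMost n g →
              coeff (f ⊗ g) (m ℕ.+ n) ≈ coeff f m * coeff g n
  ⊗-leading m       n []      g f≤ g≤ = sym (zeroˡ _)
  ⊗-leading zero    n (b ∷ f) g f≤ g≤ = coeff-const-⊗ b f g (tail≋0 {b} f≤) n
  ⊗-leading (suc m) n (b ∷ f) g f≤ g≤ = begin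
    coeff ((b ∷ f) ⊗ g) (suc (m ℕ.+ n))                       ≈⟨ coeff-∷-⊗ b f g (suc (m ℕ.+ n)) ⟩
    b * coeff g (suc (m ℕ.+ n)) + coeff (f ⊗ g) (m ℕ.+ n)
      ≈⟨ +-cong (*-congˡ (g≤ _ (s≤s (ℕ.m≤n+m n m)))) (⊗-leading m n f g (tail-degree {b = b} {f} f≤) g≤) ⟩
    b * 0# + coeff f m * coeff g n                            ≈⟨ +-congʳ (zeroʳ b) ⟩
    0# + coeff f m * coeff g n                                ≈⟨ +-identityˡ _ ⟩
    coeff f m * coeff g n                                     ∎

  -- Reversing a coefficient sequence

  -- reversal u n k is u (n ∸ k) for k ≤ n, and 0# for k > n.
  reversal : (ℕ → Carrier) → ℕ → ℕ → Carrier
  reversal u n       zero    = u n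
  reversal u zero    (suc k) = 0#
  reversal u (suc n) (suc k) = reversal u n k

  reversal-cong : ∀ {u v} → (∀ i → u i ≈ v i) → ∀ n k → reversal u n k ≈ reversal v n k
  reversal-cong u≈v n       zero    = u≈v n
  reversal-cong u≈v zero    (suc k) = refl
  reversal-cong u≈v (suc n) (suc k) = reversal-cong u≈v n k

  reversal-+ : ∀ u v n k → reversal (λ i → u i + v i) n k ≈ reversal u n k + reversal v n k
  reversal-+ u v n       zero    = refl
  reversal-+ u v zero    (suc k) = sym (+-identityˡ 0#)
  reversal-+ u v (suc n) (suc k) = reversal-+ u v n k

  reversal-* : ∀ s u n k → reversal (λ i → s * u i) n k ≈ s * reversal u n k
  reversal-* s u n       zero    = refl
  reversal-* s u zero    (suc k) = sym (zeroʳ s)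
  reversal-* s u (suc n) (suc k) = reversal-* s u n k

  reversal-0 : ∀ {u} → (∀ i → u i ≈ 0#) → ∀ n k → reversal u n k ≈ 0#
  reversal-0 u≈0 n       zero    = u≈0 n
  reversal-0 u≈0 zero    (suc k) = refl
  reversal-0 u≈0 (suc n) (suc k) = reversal-0 u≈0 n k

  -- `reversal` recurses on `n` and `k` with `u` fixed, whereas sums and lists are taken apart at
  -- the first term of `u`. This passes from one to the other: the term `u 0` lands in position
  -- `suc n`, and the remaining terms keep their positions.
  reversal-suc : ∀ u n k →
    reversal u (suc n) k ≈ coeff (monomial (u 0) (suc n)) k + reversal (u ∘ suc) n k
  reversal-suc u n       zero          = sym (+-identityˡ _)
  reversal-suc u zero    (suc zero)    = sym (+-identityʳ _)
  reversal-suc u zero    (suc (suc k)) = sym (+-identityʳ _)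
  reversal-suc u (suc n) (suc k)       = reversal-suc u n k

  coeff-∑-monomial : ∀ u n k →
    coeff (∑≤ n (λ i → monomial (u i) (n ∸ i))) k ≈ reversal u n k
  coeff-∑-monomial u zero    zero    = refl
  coeff-∑-monomial u zero    (suc k) = refl
  coeff-∑-monomial u (suc n) k       = begin
    coeff (M ⊕ foldr _⊕_ [] (map G (applyUpTo suc (suc n)))) k
      -- The summation range unfolds to 0 followed by the successors of a shorter range; reindexing
      -- by `suc` turns the rest into a sum of the same form.
      ≡⟨ ≡.cong (λ fs → coeff (M ⊕ foldr _⊕_ [] fs) k)
                (≡.trans (map-applyUpTo suc G (suc n)) (≡.sym (map-upTo (G ∘ suc) (suc n)))) ⟩
    coeff (M ⊕ ∑≤ n (G ∘ suc)) k
      ≈⟨ coeff-⊕ M (∑≤ n (G ∘ suc)) k ⟩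
    coeff M k + coeff (∑≤ n (G ∘ suc)) k
      ≈⟨ +-congˡ (coeff-∑-monomial (u ∘ suc) n k) ⟩
    coeff M k + reversal (u ∘ suc) n k
      ≈⟨ reversal-suc u n k ⟨
    reversal u (suc n) k ∎
    where
    G : ℕ → Poly
    G i = monomial (u i) (suc n ∸ i)
    M : Poly
    M = monomial (u 0) (suc n)

-- Multiplicativity of the reversal with powers of `a`

module ReversalProduct {c ℓ} (R : CommutativeRing c ℓ) (a : CommutativeRing.Carrier R) where
  open CommutativeRing R
  open Polynomials R
  open PolynomialProperties R
  open Exp semiring using () renaming (_^_ to _^ᴿ_)
  open import Relation.Binary.Reasoning.Setoid setoid
  open CommutativeSemigroupProperties *-commutativeSemigroup using (x∙yz≈y∙xz)

  scaled : Poly → ℕ → Carrier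
  scaled f i = coeff f i * a ^ᴿ i

  -- For `f` of degree at most `n` this is x^n f(a/x). The bound is kept apart from `deg f` because
  -- the induction also reverses polynomials with respect to a bound above their degree.
  reverse : ℕ → Poly → Poly
  reverse n f = ∑≤ n (λ i → monomial (scaled f i) (n ∸ i))

  coeff-reverse : ∀ n f k → coeff (reverse n f) k ≈ reversal (scaled f) n k
  coeff-reverse n f = coeff-∑-monomial (scaled f) n

  reverse-0 : ∀ n f → f ≋ [] → reverse n f ≋ []
  reverse-0 n f f≋0 k = trans (coeff-reverse n f k)
    (reversal-0 (λ i → trans (*-congʳ (f≋0 i)) (zeroˡ _)) n k)

  -- Proportionality is assumed coefficientwise, so that besides `s ⊙ f` it covers a product whose
  -- first factor is constant only up to trailing zeros.
  reverse-⊙ : ∀ n s f g → (∀ i → coeff g i ≈ s * coeff f i) →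
              ∀ k → coeff (reverse n g) k ≈ s * coeff (reverse n f) k
  reverse-⊙ n s f g g≈sf k = begin
    coeff (reverse n g) k                     ≈⟨ coeff-reverse n g k ⟩
    reversal (scaled g) n k
      ≈⟨ reversal-cong (λ i → trans (*-congʳ (g≈sf i)) (*-assoc s _ _)) n k ⟩
    reversal (λ i → s * scaled f i) n k       ≈⟨ reversal-* s (scaled f) n k ⟩
    s * reversal (scaled f) n k               ≈⟨ *-congˡ (coeff-reverse n f k) ⟨
    s * coeff (reverse n f) k                 ∎

  reverse-⊕ : ∀ n f g → reverse n (f ⊕ g) ≋ reverse n f ⊕ reverse n g
  reverse-⊕ n f g k = begin
    coeff (reverse n (f ⊕ g)) k                         ≈⟨ coeff-reverse n (f ⊕ g) k ⟩
    reversal (scaled (f ⊕ g)) n k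
      ≈⟨ reversal-cong (λ i → trans (*-congʳ (coeff-⊕ f g i)) (distribʳ _ _ _)) n k ⟩
    reversal (λ i → scaled f i + scaled g i) n k        ≈⟨ reversal-+ (scaled f) (scaled g) n k ⟩
    reversal (scaled f) n k + reversal (scaled g) n k
      ≈⟨ +-cong (coeff-reverse n f k) (coeff-reverse n g k) ⟨
    coeff (reverse n f) k + coeff (reverse n g) k       ≈⟨ coeff-⊕ (reverse n f) (reverse n g) k ⟨
    coeff (reverse n f ⊕ reverse n g) k                 ∎

  reverse-∷ : ∀ n b f → reverse (suc n) (b ∷ f) ≋ monomial b (suc n) ⊕ (a ⊙ reverse n f)
  reverse-∷ n b f k = begin
    coeff (reverse (suc n) (b ∷ f)) k
      ≈⟨ coeff-reverse (suc n) (b ∷ f) k ⟩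
    reversal (scaled (b ∷ f)) (suc n) k
      ≈⟨ reversal-suc (scaled (b ∷ f)) n k ⟩
    coeff (monomial (b * 1#) (suc n)) k + reversal (λ i → coeff f i * (a * a ^ᴿ i)) n k
      -- The factor `1#` is the zeroth power of `a`; in all later terms one factor `a` is pulled out
      -- of the power.
      ≈⟨ +-cong (monomial-cong (suc n) k) (reversal-cong (λ i → x∙yz≈y∙xz _ a _) n k) ⟩
    coeff (monomial b (suc n)) k + reversal (λ i → a * scaled f i) n k
      ≈⟨ +-congˡ (reversal-* a (scaled f) n k) ⟩
    coeff (monomial b (suc n)) k + a * reversal (scaled f) n k
      ≈⟨ +-congˡ (*-congˡ (coeff-reverse n f k)) ⟨
    coeff (monomial b (suc n)) k + a * coeff (reverse n f) k
      ≈⟨ +-congˡ (coeff-⊙ a (reverse n f) k) ⟨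
    coeff (monomial b (suc n)) k + coeff (a ⊙ reverse n f) k
      ≈⟨ coeff-⊕ (monomial b (suc n)) (a ⊙ reverse n f) k ⟨
    coeff (monomial b (suc n) ⊕ (a ⊙ reverse n f)) k ∎
    where
    monomial-cong : ∀ m → monomial (b * 1#) m ≋ monomial b m
    monomial-cong zero    zero    = *-identityʳ b
    monomial-cong zero    (suc k) = refl
    monomial-cong (suc m) zero    = refl
    monomial-cong (suc m) (suc k) = monomial-cong m k

  -- Formally, x^(n+1) (a/x) f(a/x) = a x^n f(a/x): the extra x is absorbed by the larger bound.
  reverse-0∷ : ∀ n f → reverse (suc n) (0# ∷ f) ≋ a ⊙ reverse n f
  reverse-0∷ n f k = begin
    coeff (reverse (suc n) (0# ∷ f)) k                          ≈⟨ reverse-∷ n 0# f k ⟩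
    coeff (monomial 0# (suc n) ⊕ (a ⊙ reverse n f)) k           ≈⟨ coeff-⊕ (monomial 0# (suc n)) (a ⊙ reverse n f) k ⟩
    coeff (monomial 0# (suc n)) k + coeff (a ⊙ reverse n f) k   ≈⟨ +-congʳ (monomial-0 (suc n) k) ⟩
    0# + coeff (a ⊙ reverse n f) k                              ≈⟨ +-identityˡ _ ⟩
    coeff (a ⊙ reverse n f) k                                   ∎
    where
    monomial-0 : ∀ m → monomial 0# m ≋ []
    monomial-0 zero    zero    = refl
    monomial-0 zero    (suc k) = refl
    monomial-0 (suc m) zero    = refl
    monomial-0 (suc m) (suc k) = monomial-0 m k

  -- Raising the bound from `n` to `m + n` multiplies the reversal by x^m: the new low coefficients
  -- come from coefficients of `g` above `n`, which vanish. The scalar `b` is carried along to match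
  -- `monomial-⊗`.
  reverse-shift : ∀ m n g b → DegreeAtMost n g →
    ∀ k → b * coeff (reverse (m ℕ.+ n) g) k ≈ coeff (replicate m 0# ++ (b ⊙ reverse n g)) k
  reverse-shift zero    n g b g≤ k       = sym (coeff-⊙ b (reverse n g) k)
  reverse-shift (suc m) n g b g≤ zero    = begin
    b * coeff (reverse (suc m ℕ.+ n) g) 0               ≈⟨ *-congˡ (coeff-reverse (suc m ℕ.+ n) g 0) ⟩
    b * (coeff g (suc m ℕ.+ n) * a ^ᴿ (suc m ℕ.+ n))    ≈⟨ *-congˡ (*-congʳ (g≤ _ (s≤s (ℕ.m≤n+m n m)))) ⟩
    b * (0# * a ^ᴿ (suc m ℕ.+ n))                       ≈⟨ *-congˡ (zeroˡ _) ⟩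
    b * 0#                                              ≈⟨ zeroʳ b ⟩
    0#                                                  ∎
  reverse-shift (suc m) n g b g≤ (suc k) = begin
    b * coeff (reverse (suc m ℕ.+ n) g) (suc k)         ≈⟨ *-congˡ (coeff-reverse (suc m ℕ.+ n) g (suc k)) ⟩
    b * reversal (scaled g) (m ℕ.+ n) k                 ≈⟨ *-congˡ (coeff-reverse (m ℕ.+ n) g k) ⟨
    b * coeff (reverse (m ℕ.+ n) g) k                   ≈⟨ reverse-shift m n g b g≤ k ⟩
    coeff (replicate m 0# ++ (b ⊙ reverse n g)) k       ∎

  reverse-⊗ : ∀ m n f g → DegreeAtMost m f → DegreeAtMost n g →
              reverse (m ℕ.+ n) (f ⊗ g) ≋ reverse m f ⊗ reverse n g
  reverse-⊗ m n [] g f≤ g≤ k = trans (reverse-0 (m ℕ.+ n) [] (λ _ → refl) k)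
    (sym (⊗-zeroˡ (reverse m []) (reverse n g) (reverse-0 m [] (λ _ → refl)) k))
  reverse-⊗ zero n (b ∷ f) g f≤ g≤ k = begin
    coeff (reverse n ((b ∷ f) ⊗ g)) k
      ≈⟨ reverse-⊙ n b g ((b ∷ f) ⊗ g) (coeff-const-⊗ b f g (tail≋0 {b} f≤)) k ⟩
    -- `reverse 0 (b ∷ f)` computes to the one-element list holding `b * 1#`.
    b * coeff (reverse n g) k                       ≈⟨ *-congʳ (*-identityʳ b) ⟨
    (b * 1#) * coeff (reverse n g) k
      ≈⟨ coeff-const-⊗ (b * 1#) [] (reverse n g) (λ _ → refl) k ⟨
    coeff (reverse 0 (b ∷ f) ⊗ reverse n g) k    ∎
  reverse-⊗ (suc m) n (b ∷ f) g f≤ g≤ k = begin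
    coeff (reverse N ((b ⊙ g) ⊕ (0# ∷ (f ⊗ g)))) k
      ≈⟨ reverse-⊕ N (b ⊙ g) (0# ∷ (f ⊗ g)) k ⟩
    coeff (reverse N (b ⊙ g) ⊕ reverse N (0# ∷ (f ⊗ g))) k
      ≈⟨ coeff-⊕ (reverse N (b ⊙ g)) _ k ⟩
    coeff (reverse N (b ⊙ g)) k + coeff (reverse N (0# ∷ (f ⊗ g))) k
      ≈⟨ +-cong (reverse-⊙ N b g (b ⊙ g) (coeff-⊙ b g) k) (reverse-0∷ (m ℕ.+ n) (f ⊗ g) k) ⟩
    b * coeff (reverse N g) k + coeff (a ⊙ reverse (m ℕ.+ n) (f ⊗ g)) k
      -- The summand b g is reversed with a bound `suc m` too large, which supplies the factor b
      -- x^(m+1), the first term of `reverse (suc m) (b ∷ f)`.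
      ≈⟨ +-cong (reverse-shift (suc m) n g b g≤ k) (coeff-⊙ a (reverse (m ℕ.+ n) (f ⊗ g)) k) ⟩
    coeff (replicate (suc m) 0# ++ (b ⊙ h)) k + a * coeff (reverse (m ℕ.+ n) (f ⊗ g)) k
      ≈⟨ +-cong (sym (monomial-⊗ b (suc m) h k))
                (*-congˡ (reverse-⊗ m n f g (tail-degree {b = b} {f} f≤) g≤ k)) ⟩
    coeff (monomial b (suc m) ⊗ h) k + a * coeff (reverse m f ⊗ h) k
      ≈⟨ +-congˡ (trans (⊙-⊗-assoc a (reverse m f) h k) (coeff-⊙ a (reverse m f ⊗ h) k)) ⟨
    coeff (monomial b (suc m) ⊗ h) k + coeff ((a ⊙ reverse m f) ⊗ h) k
      ≈⟨ coeff-⊕ (monomial b (suc m) ⊗ h) _ k ⟨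
    coeff ((monomial b (suc m) ⊗ h) ⊕ ((a ⊙ reverse m f) ⊗ h)) k
      ≈⟨ ⊗-distribʳ-⊕ h (monomial b (suc m)) (a ⊙ reverse m f) k ⟨
    coeff ((monomial b (suc m) ⊕ (a ⊙ reverse m f)) ⊗ h) k
      ≈⟨ ⊗-congʳ (reverse (suc m) (b ∷ f)) (monomial b (suc m) ⊕ (a ⊙ reverse m f)) h (reverse-∷ m b f) k ⟨
    coeff (reverse (suc m) (b ∷ f) ⊗ h) k ∎
    where
    N : ℕ
    N = suc m ℕ.+ n
    h : Poly
    h = reverse n g

-- Exact degrees, inverses and reciprocals over a finite field

module ReciprocalProperties {c ℓ} {q : ℕ} (F : FiniteField c ℓ q) where
  open FiniteField F
  open Reciprocal F
  open CommutativeRing commutativeRing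
    using (setoid; refl; sym; trans; *-cong; *-congˡ; *-congʳ; *-assoc; *-identityˡ; *-identityʳ;
           zeroˡ; *-commutativeSemigroup)
  open PolynomialProperties commutativeRing
  open import Relation.Binary.Reasoning.Setoid setoid
  open CommutativeSemigroupProperties *-commutativeSemigroup using (interchange)

  All-0⇒≋0 : ∀ {f} → All (_≈ 0#) f → f ≋ []
  All-0⇒≋0 []           i       = refl
  All-0⇒≋0 (b≈0 ∷ f≈0) zero    = b≈0
  All-0⇒≋0 (b≈0 ∷ f≈0) (suc i) = All-0⇒≋0 f≈0 i

  ≋0⇒All-0 : ∀ f → f ≋ [] → All (_≈ 0#) f
  ≋0⇒All-0 []      f≋0 = []
  ≋0⇒All-0 (b ∷ f) f≋0 = f≋0 0 ∷ ≋0⇒All-0 f (f≋0 ∘ suc)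

  degreeAtMost-deg : ∀ f → DegreeAtMost (deg f) f
  degreeAtMost-deg []      i _ = refl
  degreeAtMost-deg (b ∷ f) i d<i with all? (_≟ 0#) f
  degreeAtMost-deg (b ∷ f) (suc i) d<i | yes f≈0 = All-0⇒≋0 f≈0 i
  degreeAtMost-deg (b ∷ f) (suc i) d<i | no  _   = degreeAtMost-deg f i (s≤s⁻¹ d<i)

  -- `deg` branches on whether the tail is zero. For positive `n` the nonzero coefficient rules out
  -- a zero tail; for `n` equal to 0 the bound forces one.
  deg-unique : ∀ n f → DegreeAtMost n f → coeff f n ≉ 0# → deg f ≡ n
  deg-unique n [] f≤ fₙ≉0 = contradiction refl fₙ≉0
  deg-unique n (b ∷ f) f≤ fₙ≉0 with all? (_≟ 0#) f
  deg-unique zero    (b ∷ f) f≤ fₙ≉0 | yes _   = ≡.refl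
  deg-unique (suc n) (b ∷ f) f≤ fₙ≉0 | yes f≈0 = contradiction (All-0⇒≋0 f≈0 n) fₙ≉0
  deg-unique zero    (b ∷ f) f≤ fₙ≉0 | no f≉0  = contradiction (≋0⇒All-0 f (tail≋0 {b} f≤)) f≉0
  deg-unique (suc n) (b ∷ f) f≤ fₙ≉0 | no _    =
    ≡.cong suc (deg-unique n f (tail-degree {b = b} {f} f≤) fₙ≉0)

  nonzero⇒1≉0 : ∀ {x} → x ≉ 0# → 1# ≉ 0#
  nonzero⇒1≉0 {x} x≉0 1≈0 =
    x≉0 (trans (sym (*-identityˡ x)) (trans (*-congʳ 1≈0) (zeroˡ x)))

  -- The coefficient at the sum of the degrees is 1 · 1 = 1, which is nonzero, so the upper bound is
  -- attained.
  deg-⊗ : 1# ≉ 0# → ∀ f g → Monic f → Monic g → deg (f ⊗ g) ≡ deg f ℕ.+ deg g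
  deg-⊗ 1≉0 f g fM gM = deg-unique (deg f ℕ.+ deg g) (f ⊗ g)
    (⊗-degree (deg f) (deg g) f g (degreeAtMost-deg f) (degreeAtMost-deg g))
    (λ lead≈0 → 1≉0 (trans (sym leading≈1) lead≈0))
    where
    leading≈1 : coeff (f ⊗ g) (deg f ℕ.+ deg g) ≈ 1#
    leading≈1 = trans (⊗-leading (deg f) (deg g) f g (degreeAtMost-deg f) (degreeAtMost-deg g))
      (trans (*-cong fM gM) (*-identityˡ 1#))

  inverseˡ : ∀ x (x≉0 : x ≉ 0#) → inverse x x≉0 * x ≈ 1#
  inverseˡ x x≉0 = proj₁ (proj₂ (invertible x≉0))

  inverseʳ : ∀ x (x≉0 : x ≉ 0#) → x * inverse x x≉0 ≈ 1#
  inverseʳ x x≉0 = proj₂ (proj₂ (invertible x≉0))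

  -- Stated for a separate `z` because the value of `f ⊗ g` at 0 is only `≈` to the product of
  -- values, and `inverse` takes its own proof of nonvanishing.
  inverse-* : ∀ x y z (x≉0 : x ≉ 0#) (y≉0 : y ≉ 0#) (z≉0 : z ≉ 0#) → z ≈ x * y →
              inverse z z≉0 ≈ inverse x x≉0 * inverse y y≉0
  inverse-* x y z x≉0 y≉0 z≉0 z≈xy = begin
    z⁻¹                             ≈⟨ *-identityʳ z⁻¹ ⟨
    z⁻¹ * 1#                        ≈⟨ *-congˡ (*-identityˡ 1#) ⟨
    z⁻¹ * (1# * 1#)                 ≈⟨ *-congˡ (*-cong (inverseʳ x x≉0) (inverseʳ y y≉0)) ⟨
    z⁻¹ * ((x * x⁻¹) * (y * y⁻¹))   ≈⟨ *-congˡ (interchange x x⁻¹ y y⁻¹) ⟩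
    z⁻¹ * ((x * y) * (x⁻¹ * y⁻¹))   ≈⟨ *-congˡ (*-congʳ z≈xy) ⟨
    z⁻¹ * (z * (x⁻¹ * y⁻¹))         ≈⟨ *-assoc z⁻¹ z _ ⟨
    (z⁻¹ * z) * (x⁻¹ * y⁻¹)         ≈⟨ *-congʳ (inverseˡ z z≉0) ⟩
    1# * (x⁻¹ * y⁻¹)                ≈⟨ *-identityˡ _ ⟩
    x⁻¹ * y⁻¹                       ∎
    where
    x⁻¹ = inverse x x≉0
    y⁻¹ = inverse y y≉0
    z⁻¹ = inverse z z≉0

  reciprocal-⊗ : ∀ a f g → Monic f → Monic g → (f0 : NonzeroAt0 f) (g0 : NonzeroAt0 g) →
    reciprocal a (f ⊗ g) (⊗-nonzeroAt0 f g f0 g0) ≋ reciprocal a f f0 ⊗ reciprocal a g g0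
  reciprocal-⊗ a f g fM gM f0 g0 k = begin
    coeff (t ⊙ reverse (deg (f ⊗ g)) (f ⊗ g)) k
      -- The reciprocal unfolds to a scaled `reverse` with bound `deg (f ⊗ g)`; `reverse-⊗` needs
      -- the bound as a sum. That `1#` is nonzero follows from f(0) being nonzero.
      ≡⟨ ≡.cong (λ n → coeff (t ⊙ reverse n (f ⊗ g)) k) (deg-⊗ (nonzero⇒1≉0 f0) f g fM gM) ⟩
    coeff (t ⊙ reverse (deg f ℕ.+ deg g) (f ⊗ g)) k
      ≈⟨ coeff-⊙ t (reverse (deg f ℕ.+ deg g) (f ⊗ g)) k ⟩
    t * coeff (reverse (deg f ℕ.+ deg g) (f ⊗ g)) k
      ≈⟨ *-cong (inverse-* (eval f 0#) (eval g 0#) (eval (f ⊗ g) 0#) f0 g0 _ (eval-⊗ f g 0#))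
                (reverse-⊗ (deg f) (deg g) f g (degreeAtMost-deg f) (degreeAtMost-deg g) k) ⟩
    (r * s) * coeff (Rf ⊗ Rg) k
      ≈⟨ *-assoc r s _ ⟩
    r * (s * coeff (Rf ⊗ Rg) k)
      -- The normalising constant has split as `r * s`; each scalar is now moved into its own
      -- factor.
      ≈⟨ *-congˡ (trans (⊗-⊙-comm s Rf Rg k) (coeff-⊙ s (Rf ⊗ Rg) k)) ⟨
    r * coeff (Rf ⊗ (s ⊙ Rg)) k
      ≈⟨ trans (⊙-⊗-assoc r Rf (s ⊙ Rg) k) (coeff-⊙ r (Rf ⊗ (s ⊙ Rg)) k) ⟨
    coeff ((r ⊙ Rf) ⊗ (s ⊙ Rg)) k ∎
    where
    open ReversalProduct commutativeRing a
    r s t : Carrier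
    r = inverse (eval f 0#) f0
    s = inverse (eval g 0#) g0
    t = inverse (eval (f ⊗ g) 0#) (⊗-nonzeroAt0 f g f0 g0)
    Rf Rg : Poly
    Rf = reverse (deg f) f
    Rg = reverse (deg g) g

theorem1 : ∀ {c ℓ} (p e q : ℕ) → Prime p → e ≥ 1 → q ≡ p ^ e → ¬ (2 ∣ q) →
    (F : FiniteField c ℓ q) →
    let open FiniteField F
        open Reciprocal F
    in
    (a : Carrier) → a ≉ 0# →
    (f g : Poly) → Monic f → Monic g →
    (f0 : NonzeroAt0 f) (g0 : NonzeroAt0 g) →
    reciprocal a (f ⊗ g) (⊗-nonzeroAt0 f g f0 g0) ≋ reciprocal a f f0 ⊗ reciprocal a g g0
theorem1 _ _ _ _ _ _ _ F a _ f g fM gM f0 g0 =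
  ReciprocalProperties.reciprocal-⊗ F a f g fM gM f0 g0
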